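{- Let $\mathcal{C}\subseteq 2^{[n]}$ and $\mathcal{D}\subseteq 2^{[m]}$ be nonempty codes, and let $\mathcal{C}\times\mathcal{D}=\{c\cup(d+n)\mid c\in\mathcal{C},d\in\mathcal{D}\}\subseteq 2^{[n+m]}$, where $d+n=\{j+n\mid j\in d\}$. Then $\mathcal{C}$ and $\mathcal{D}$ are both convex if and only if $\mathcal{C}\times\mathcal{D}$ is convex, and in that case $\mathrm{mindim}(\mathcal{C}\times\mathcal{D})\le\mathrm{mindim}(\mathcal{C})+\mathrm{mindim}(\mathcal{D})$.
   Context: A code is a subset $\mathcal{C}\subseteq 2^{[n]}$. Given $U_1,\dots,U_n\subseteq X$, $\mathrm{code}(\mathcal{U},X)=\{\sigma\subseteq[n]\mid \bigcap_{i\in\sigma}U_i\setminus\bigcup_{j\notin\sigma}U_j\neq\emptyset\}$ with the empty intersection equal to $X$. A code is convex if it equals $\mathrm{code}(\mathcal{U},X)$ for some open convex $X\subseteq\mathbb{R}^d$ and convex open $U_i\subseteq X$; $\mathrm{mindim}$ is the least such $d$. -}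

module Defs where

open import Data.Fin.Base using (Fin)
import Data.Fin.Subset as Subset
open Subset using (Subset)
import Data.Fin.Subset.Properties as Subset
open import Data.List.Base using (List; cartesianProductWith)
import Data.List.Membership.Propositional as List
open import Data.Nat.Base as ℕ using (ℕ; _⊔_)
import Data.Nat.Properties as ℕ
open import Data.Nat.Induction using (<-rec)
open import Data.Product.Base using (Σ; ∃; _×_; _,_; proj₁; proj₂)
open import Data.Rational.Base as ℚ using (ℚ; 0ℚ; 1ℚ; ½; ∣_∣; Positive; positive)
import Data.Rational.Properties as ℚ
import Data.Rational.Solver as ℚ
open import Data.Vec.Base using (_++_)
open import Data.Vec.Functional as Vector using (Vector)
open import Function.Base using (_∘_)
open import Level using (0ℓ)
open import Relation.Binary.PropositionalEquality using (_≡_; refl; sym; trans; cong; cong₂; subst)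
open import Relation.Nullary.Negation using (¬_)
open import Relation.Unary using (Pred; _∈_; _⊆_; _∩_; _∖_; _≐_; ⋂; ⋃; Satisfiable)

------------------------------------------------------------------------
-- Real numbers, represented by Cauchy sequences of rationals

Cauchy : (ℕ → ℚ) → Set
Cauchy x = ∀ ε → 0ℚ ℚ.< ε →
  ∃ λ N → ∀ m n → N ℕ.≤ m → N ℕ.≤ n → ∣ x m ℚ.- x n ∣ ℚ.< ε

-- Two sequences whose difference tends to 0 represent the same real, so
-- propositional equality is not equality of reals.  No quotient is needed
-- below: the order only depends on the reals represented, and an open set
-- (see `Open`) contains all representatives of each of its points.
record ℝ : Set where
  constructor mkℝ
  field
    seq    : ℕ → ℚ
    cauchy : Cauchy seq

open ℝ public

private

  module Identities where
    open ℚ.+-*-Solver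

    split : ∀ p q → p ≡ (p ℚ.- q) ℚ.+ q
    split = solve 2 (λ p q → p := (p :- q) :+ q) refl

    diff-+ : ∀ p q p′ q′ →
      (p ℚ.+ q) ℚ.- (p′ ℚ.+ q′) ≡ (p ℚ.- p′) ℚ.+ (q ℚ.- q′)
    diff-+ = solve 4 (λ p q p′ q′ →
      (p :+ q) :- (p′ :+ q′) := (p :- p′) :+ (q :- q′)) refl

    diff-* : ∀ p q p′ q′ →
      p ℚ.* q ℚ.- p′ ℚ.* q′ ≡ p ℚ.* (q ℚ.- q′) ℚ.+ q′ ℚ.* (p ℚ.- p′)
    diff-* = solve 4 (λ p q p′ q′ →
      p :* q :- p′ :* q′ := p :* (q :- q′) :+ q′ :* (p :- p′)) refl

  open Identities

  ε/2>0 : ∀ {ε} → 0ℚ ℚ.< ε → 0ℚ ℚ.< ½ ℚ.* ε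
  ε/2>0 {ε} ε>0 =
    ℚ.positive⁻¹ (½ ℚ.* ε) {{ℚ.pos*pos⇒pos ½ ε {{positive ε>0}}}}

  ε/2+ε/2 : ∀ ε → ½ ℚ.* ε ℚ.+ ½ ℚ.* ε ≡ ε
  ε/2+ε/2 ε = trans (sym (ℚ.*-distribʳ-+ ε ½ ½)) (ℚ.*-identityˡ ε)

  shrink : ∀ B ε → 0ℚ ℚ.< B → 0ℚ ℚ.< ε → ∃ λ δ → 0ℚ ℚ.< δ × B ℚ.* δ ≡ ε
  shrink B ε B>0 ε>0 = B⁻¹ ℚ.* ε
    , ℚ.positive⁻¹ (B⁻¹ ℚ.* ε)
        {{ℚ.pos*pos⇒pos B⁻¹ {{ℚ.1/pos⇒pos B}} ε {{positive ε>0}}}}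
    , trans (sym (ℚ.*-assoc B B⁻¹ ε))
        (trans (cong (ℚ._* ε) (ℚ.*-inverseʳ B)) (ℚ.*-identityˡ ε))
    where
    instance
      B-pos : Positive B
      B-pos = positive B>0
      B-nonZero : ℚ.NonZero B
      B-nonZero = ℚ.pos⇒nonZero B
    B⁻¹ : ℚ
    B⁻¹ = ℚ.1/ B

  bounded : ∀ {x} → Cauchy x →
    ∃ λ B → ∃ λ N → 0ℚ ℚ.< B × (∀ n → N ℕ.≤ n → ∣ x n ∣ ℚ.≤ B)
  bounded {x} cx = B , N , B>0 , bound
    where
    c = cx 1ℚ (ℚ.positive⁻¹ 1ℚ)
    N = proj₁ c
    B = 1ℚ ℚ.+ ∣ x N ∣
    B>0 : 0ℚ ℚ.< B
    B>0 = ℚ.+-mono-<-≤ (ℚ.positive⁻¹ 1ℚ) (ℚ.0≤∣p∣ (x N))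
    bound : ∀ n → N ℕ.≤ n → ∣ x n ∣ ℚ.≤ B
    bound n N≤n = begin
      ∣ x n ∣                        ≡⟨ cong ∣_∣ (split (x n) (x N)) ⟩
      ∣ (x n ℚ.- x N) ℚ.+ x N ∣      ≤⟨ ℚ.∣p+q∣≤∣p∣+∣q∣ (x n ℚ.- x N) (x N) ⟩
      ∣ x n ℚ.- x N ∣ ℚ.+ ∣ x N ∣    ≤⟨ ℚ.+-monoˡ-≤ ∣ x N ∣ (ℚ.<⇒≤ (proj₂ c n N N≤n ℕ.≤-refl)) ⟩
      B                              ∎
      where open ℚ.≤-Reasoning

  *-bound : ∀ {p q B} → ∣ p ∣ ℚ.≤ B → ∣ p ℚ.* q ∣ ℚ.≤ B ℚ.* ∣ q ∣
  *-bound {p} {q} {B} p≤B = begin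
    ∣ p ℚ.* q ∣        ≡⟨ ℚ.∣p*q∣≡∣p∣*∣q∣ p q ⟩
    ∣ p ∣ ℚ.* ∣ q ∣    ≤⟨ ℚ.*-monoʳ-≤-nonNeg ∣ q ∣ {{ℚ.∣-∣-nonNeg q}} p≤B ⟩
    B ℚ.* ∣ q ∣        ∎
    where open ℚ.≤-Reasoning

  *-close : ∀ p q p′ q′ {A B δ η} → 0ℚ ℚ.< A → 0ℚ ℚ.< B →
    ∣ p ∣ ℚ.≤ A → ∣ q′ ∣ ℚ.≤ B → ∣ q ℚ.- q′ ∣ ℚ.< δ → ∣ p ℚ.- p′ ∣ ℚ.< η →
    ∣ p ℚ.* q ℚ.- p′ ℚ.* q′ ∣ ℚ.< A ℚ.* δ ℚ.+ B ℚ.* η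
  *-close p q p′ q′ {A} {B} {δ} {η} A>0 B>0 p≤A q′≤B q-close p-close = begin-strict
    ∣ p ℚ.* q ℚ.- p′ ℚ.* q′ ∣
      ≡⟨ cong ∣_∣ (diff-* p q p′ q′) ⟩
    ∣ p ℚ.* (q ℚ.- q′) ℚ.+ q′ ℚ.* (p ℚ.- p′) ∣
      ≤⟨ ℚ.∣p+q∣≤∣p∣+∣q∣ (p ℚ.* (q ℚ.- q′)) (q′ ℚ.* (p ℚ.- p′)) ⟩
    ∣ p ℚ.* (q ℚ.- q′) ∣ ℚ.+ ∣ q′ ℚ.* (p ℚ.- p′) ∣
      ≤⟨ ℚ.+-mono-≤ (*-bound {p} {q ℚ.- q′} p≤A) (*-bound {q′} {p ℚ.- p′} q′≤B) ⟩
    A ℚ.* ∣ q ℚ.- q′ ∣ ℚ.+ B ℚ.* ∣ p ℚ.- p′ ∣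
      <⟨ ℚ.+-mono-< (ℚ.*-monoʳ-<-pos A {{positive A>0}} q-close)
                    (ℚ.*-monoʳ-<-pos B {{positive B>0}} p-close) ⟩
    A ℚ.* δ ℚ.+ B ℚ.* η ∎
    where open ℚ.≤-Reasoning

abstract

  const-cauchy : ∀ q → Cauchy (λ _ → q)
  const-cauchy q ε ε>0 = 0 , λ _ _ _ _ →
    subst (λ r → ∣ r ∣ ℚ.< ε) (sym (ℚ.+-inverseʳ q)) ε>0

  neg-cauchy : ∀ x → Cauchy x → Cauchy (λ n → ℚ.- x n)
  neg-cauchy x cx ε ε>0 = proj₁ (cx ε ε>0) , λ m n N≤m N≤n →
    subst (ℚ._< ε)
      (trans (sym (ℚ.∣-p∣≡∣p∣ (x m ℚ.- x n)))
        (cong ∣_∣ (ℚ.neg-distrib-+ (x m) (ℚ.- x n))))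
      (proj₂ (cx ε ε>0) m n N≤m N≤n)

  +-cauchy : ∀ x y → Cauchy x → Cauchy y → Cauchy (λ n → x n ℚ.+ y n)
  +-cauchy x y cx cy ε ε>0 = M ⊔ N , close
    where
    c : ∃ λ N → ∀ m n → N ℕ.≤ m → N ℕ.≤ n → ∣ x m ℚ.- x n ∣ ℚ.< ½ ℚ.* ε
    c = cx (½ ℚ.* ε) (ε/2>0 ε>0)
    d : ∃ λ N → ∀ m n → N ℕ.≤ m → N ℕ.≤ n → ∣ y m ℚ.- y n ∣ ℚ.< ½ ℚ.* ε
    d = cy (½ ℚ.* ε) (ε/2>0 ε>0)
    M N : ℕ
    M = proj₁ c
    N = proj₁ d
    close : ∀ m n → M ⊔ N ℕ.≤ m → M ⊔ N ℕ.≤ n →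
            ∣ (x m ℚ.+ y m) ℚ.- (x n ℚ.+ y n) ∣ ℚ.< ε
    close m n ≤m ≤n = begin-strict
      ∣ (x m ℚ.+ y m) ℚ.- (x n ℚ.+ y n) ∣
        ≡⟨ cong ∣_∣ (diff-+ (x m) (y m) (x n) (y n)) ⟩
      ∣ (x m ℚ.- x n) ℚ.+ (y m ℚ.- y n) ∣
        ≤⟨ ℚ.∣p+q∣≤∣p∣+∣q∣ (x m ℚ.- x n) (y m ℚ.- y n) ⟩
      ∣ x m ℚ.- x n ∣ ℚ.+ ∣ y m ℚ.- y n ∣
        <⟨ ℚ.+-mono-< (proj₂ c m n (ℕ.m⊔n≤o⇒m≤o M N ≤m) (ℕ.m⊔n≤o⇒m≤o M N ≤n))
                      (proj₂ d m n (ℕ.m⊔n≤o⇒n≤o M N ≤m) (ℕ.m⊔n≤o⇒n≤o M N ≤n)) ⟩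
      ½ ℚ.* ε ℚ.+ ½ ℚ.* ε
        ≡⟨ ε/2+ε/2 ε ⟩
      ε ∎
      where open ℚ.≤-Reasoning

  *-cauchy : ∀ x y → Cauchy x → Cauchy y → Cauchy (λ n → x n ℚ.* y n)
  *-cauchy x y cx cy ε ε>0 =
    let A , K , A>0 , x≤A = bounded cx
        B , L , B>0 , y≤B = bounded cy
        δ , δ>0 , Aδ≡ = shrink A (½ ℚ.* ε) A>0 (ε/2>0 ε>0)
        η , η>0 , Bη≡ = shrink B (½ ℚ.* ε) B>0 (ε/2>0 ε>0)
        M , y-close = cy δ δ>0
        N , x-close = cx η η>0
    in (K ⊔ L) ⊔ (M ⊔ N) , λ m n ≤m ≤n →
      subst (∣ x m ℚ.* y m ℚ.- x n ℚ.* y n ∣ ℚ.<_)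
        (trans (cong₂ ℚ._+_ Aδ≡ Bη≡) (ε/2+ε/2 ε))
        (*-close (x m) (y m) (x n) (y n) A>0 B>0
          (x≤A m (ℕ.m⊔n≤o⇒m≤o K L (ℕ.m⊔n≤o⇒m≤o (K ⊔ L) (M ⊔ N) ≤m)))
          (y≤B n (ℕ.m⊔n≤o⇒n≤o K L (ℕ.m⊔n≤o⇒m≤o (K ⊔ L) (M ⊔ N) ≤n)))
          (y-close m n (ℕ.m⊔n≤o⇒m≤o M N (ℕ.m⊔n≤o⇒n≤o (K ⊔ L) (M ⊔ N) ≤m))
                       (ℕ.m⊔n≤o⇒m≤o M N (ℕ.m⊔n≤o⇒n≤o (K ⊔ L) (M ⊔ N) ≤n)))
          (x-close m n (ℕ.m⊔n≤o⇒n≤o M N (ℕ.m⊔n≤o⇒n≤o (K ⊔ L) (M ⊔ N) ≤m))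
                       (ℕ.m⊔n≤o⇒n≤o M N (ℕ.m⊔n≤o⇒n≤o (K ⊔ L) (M ⊔ N) ≤n))))

infixl 6 _+_ _-_
infixl 7 _*_
infix  4 _<_ _≤_

0ℝ 1ℝ : ℝ
0ℝ = mkℝ (λ _ → 0ℚ) (const-cauchy 0ℚ)
1ℝ = mkℝ (λ _ → 1ℚ) (const-cauchy 1ℚ)

_+_ _-_ _*_ : ℝ → ℝ → ℝ
x + y = mkℝ (λ n → seq x n ℚ.+ seq y n) (+-cauchy (seq x) (seq y) (cauchy x) (cauchy y))
x - y = mkℝ (λ n → seq x n ℚ.- seq y n)
  (+-cauchy (seq x) (λ n → ℚ.- seq y n) (cauchy x) (neg-cauchy (seq y) (cauchy y)))
x * y = mkℝ (λ n → seq x n ℚ.* seq y n) (*-cauchy (seq x) (seq y) (cauchy x) (cauchy y))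

_<_ _≤_ : ℝ → ℝ → Set
x < y = ∃ λ ε → 0ℚ ℚ.< ε ×
  (∃ λ N → ∀ n → N ℕ.≤ n → seq x n ℚ.+ ε ℚ.≤ seq y n)
x ≤ y = ¬ (y < x)

------------------------------------------------------------------------
-- Euclidean space

ℝ^ : ℕ → Set
ℝ^ d = Vector ℝ d

dist² : ∀ {d} → ℝ^ d → ℝ^ d → ℝ
dist² x y = Vector.foldr _+_ 0ℝ (λ i → (x i - y i) * (x i - y i))

Open : ∀ {d} → Pred (ℝ^ d) 0ℓ → Set
Open U = ∀ x → x ∈ U →
  ∃ λ ε → 0ℝ < ε × (∀ y → dist² x y < ε * ε → y ∈ U)

ConvexSet : ∀ {d} → Pred (ℝ^ d) 0ℓ → Set
ConvexSet U = ∀ x y → x ∈ U → y ∈ U → ∀ t → 0ℝ ≤ t → t ≤ 1ℝ →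
  (λ i → (1ℝ - t) * x i + t * y i) ∈ U

------------------------------------------------------------------------
-- Codes

-- `Subset n` is the type of subsets of an n-element set.  A set of these is
-- given by listing its elements; order and multiplicity play no role, since
-- codes are only used through list membership.
Code : ℕ → Set
Code n = List (Subset n)

-- The first n coordinates of the concatenation c ++ d are those of c and the
-- last m are those of d, so c ++ d is the set c ∪ (d + n).
infixr 7 _×ᶜ_
_×ᶜ_ : ∀ {n m} → Code n → Code m → Code (n ℕ.+ m)
_×ᶜ_ = cartesianProductWith _++_

-- Intersecting with X matters only for σ = ∅, as each U i is contained in X.
code : ∀ {d n} → (Fin n → Pred (ℝ^ d) 0ℓ) → Pred (ℝ^ d) 0ℓ → Pred (Subset n) 0ℓ
code {n = n} U X σ = Satisfiable
  ((X ∩ ⋂ (Σ (Fin n) (Subset._∈ σ)) (U ∘ proj₁)) ∖ ⋃ (Σ (Fin n) (Subset._∉ σ)) (U ∘ proj₁))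

record ConvexIn {n} (d : ℕ) (C : Code n) : Set₁ where
  field
    X        : Pred (ℝ^ d) 0ℓ
    U        : Fin n → Pred (ℝ^ d) 0ℓ
    X-open   : Open X
    X-convex : ConvexSet X
    U⊆X      : ∀ i → U i ⊆ X
    U-open   : ∀ i → Open (U i)
    U-convex : ∀ i → ConvexSet (U i)
    C≐code   : (List._∈ C) ≐ code U X

Convex : ∀ {n} → Code n → Set₁
Convex C = ∃ λ d → ConvexIn d C

-- mindim is a relation rather than a function because the least dimension
-- cannot be computed from a realization; it is unique by antisymmetry.
IsMinDim : ∀ {n} → Code n → ℕ → Set₁
IsMinDim C d = ConvexIn d C × (∀ e → ConvexIn e C → d ℕ.≤ e)

minDim-exists : ∀ {n} (C : Code n) → Convex C → ¬ ¬ ∃ (IsMinDim C)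
minDim-exists C (d , conv) none = <-rec (λ d → ¬ ConvexIn d C) step d conv
  where
  step : ∀ d → (∀ {e} → e ℕ.< d → ¬ ConvexIn e C) → ¬ ConvexIn d C
  step d ih conv = none (d , conv , λ e conv′ → ℕ.≮⇒≥ (λ e<d → ih e<d conv′))

{-# OPTIONS --safe #-}

-- If C and D are realized by (U, X) and (V, Y), then the cylinders over the
-- U i and over the V j inside X × Y realize C × D in the sum of the
-- dimensions.  Conversely a realization of C × D realizes C after forgetting
-- the sets of the last m indices: as D has a codeword, every codeword of C is
-- still taken, and a point of the realization has some atom of C × D, whose
-- first half is its atom for the remaining sets.
module Submission where

open import Defs using (Code; Convex; IsMinDim; _×ᶜ_; ConvexIn; code)
open import Defs using (ℝ; mkℝ; seq; const-cauchy; ℝ^; dist²; Open; ConvexSet)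
open import Data.Bool.Base using (true; false)
import Data.Bool.Properties as Bool
open import Data.Fin.Base using (Fin; zero; suc; _↑ˡ_; _↑ʳ_; splitAt; join)
import Data.Fin.Properties as Fin
open import Data.Fin.Subset using (Subset; _∈_; _∉_)
open import Data.List.Base using ([]; _∷_)
import Data.List.Membership.DecPropositional as DecMembership
import Data.List.Membership.Propositional as List
open import Data.List.Membership.Propositional.Properties using (∈-cartesianProductWith⁺; ∈-cartesianProductWith⁻)
open import Data.List.Relation.Unary.Any using (here)
open import Data.Nat.Base as ℕ using (ℕ; _+_; _≤_)
import Data.Nat.Properties as ℕ
open import Data.Product.Base using (∃; _×_; _,_; proj₁; proj₂)
open import Data.Rational.Base as ℚ using (ℚ; 0ℚ; nonNegative; nonPositive; positive)
import Data.Rational.Properties as ℚ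
open import Data.Sum.Base using (inj₁; inj₂)
open import Data.Vec.Base as Vec using (Vec; lookup; tabulate)
import Data.Vec.Properties as Vec
open import Data.Vec.Functional as Vector using (Vector)
import Data.Vec.Functional.Properties as Vector
open import Effect.Monad using (RawMonad)
open import Function.Base using (_∘_)
open import Function.Bundles using (_⇔_; mk⇔; Equivalence)
open import Level using (0ℓ)
open import Relation.Binary.PropositionalEquality using (_≡_; _≢_; refl; sym; trans; cong; cong₂; subst; subst₂)
open import Relation.Nullary.Decidable using (Dec; does; proof; ¬¬-excluded-middle; decidable-stable)
open import Relation.Nullary.Negation using (¬_; contradiction; ¬¬-Monad; ¬¬-map)
open import Relation.Nullary.Reflects using (Reflects; ofʸ; ofⁿ; det)
open import Relation.Unary using (Pred)

private
  variable
    d e k l m n : ℕ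

-- Indices of a sum and vectors.

↑-elim : (P : Pred (Fin (m + n)) 0ℓ) →
  (∀ i → P (i ↑ˡ n)) → (∀ j → P (m ↑ʳ j)) → ∀ k → P k
↑-elim {m} {n} P left right k = subst P (Fin.join-splitAt m n k) (at (splitAt m k))
  where
  at : ∀ s → P (join m n s)
  at (inj₁ i) = left i
  at (inj₂ j) = right j

lookup-ext : ∀ {A : Set} {xs ys : Vec A n} → (∀ i → lookup xs i ≡ lookup ys i) → xs ≡ ys
lookup-ext {xs = xs} {ys} eq =
  trans (sym (Vec.tabulate∘lookup xs)) (trans (Vec.tabulate-cong eq) (Vec.tabulate∘lookup ys))

-- Order on rationals and on their Cauchy sequences.

square-nonNeg : ∀ p → 0ℚ ℚ.≤ p ℚ.* p
square-nonNeg p with ℚ.≤-total 0ℚ p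
... | inj₁ 0≤p = ℚ.nonNegative⁻¹ (p ℚ.* p)
  {{ℚ.nonNeg*nonNeg⇒nonNeg p {{nonNegative 0≤p}} p {{nonNegative 0≤p}}}}
... | inj₂ p≤0 = ℚ.nonNegative⁻¹ (p ℚ.* p)
  {{ℚ.nonPos*nonPos⇒nonPos p {{nonPositive p≤0}} p {{nonPositive p≤0}}}}

square-mono : ∀ {p q} → 0ℚ ℚ.≤ p → p ℚ.≤ q → p ℚ.* p ℚ.≤ q ℚ.* q
square-mono {p} {q} 0≤p p≤q = ℚ.≤-trans
  (ℚ.*-monoʳ-≤-nonNeg p {{nonNegative 0≤p}} p≤q)
  (ℚ.*-monoˡ-≤-nonNeg q {{nonNegative (ℚ.≤-trans 0≤p p≤q)}} p≤q)

⊓-pos : ∀ {p q} → 0ℚ ℚ.< p → 0ℚ ℚ.< q → 0ℚ ℚ.< p ℚ.⊓ q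
⊓-pos {p} {q} p>0 q>0 with ℚ.⊓-sel p q
... | inj₁ p⊓q≡p = subst (0ℚ ℚ.<_) (sym p⊓q≡p) p>0
... | inj₂ p⊓q≡q = subst (0ℚ ℚ.<_) (sym p⊓q≡q) q>0

-- The rational gap that witnesses `x < y` serves for `x′ < y′` as well. The second comparison is
-- asked only from `N` on because a rational below a real radius bounds its sequence only
-- eventually.
<-mono-eventually : ∀ (x x′ y y′ : ℝ) N →
  (∀ n → seq x′ n ℚ.≤ seq x n) → (∀ n → N ≤ n → seq y n ℚ.≤ seq y′ n) →
  x Defs.< y → x′ Defs.< y′
<-mono-eventually _ _ _ _ N x′≤x y≤y′ (ε , ε>0 , M , x+ε≤y) =
  ε , ε>0 , M ℕ.⊔ N , λ n ≤n → ℚ.≤-trans (ℚ.+-monoˡ-≤ ε (x′≤x n))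
    (ℚ.≤-trans (x+ε≤y n (ℕ.m⊔n≤o⇒m≤o M N ≤n)) (y≤y′ n (ℕ.m⊔n≤o⇒n≤o M N ≤n)))

-- Squared distances under projection.

dist²-nonNeg : ∀ (x y : ℝ^ d) n → 0ℚ ℚ.≤ seq (dist² x y) n
dist²-nonNeg {0}       x y n = ℚ.≤-refl
dist²-nonNeg {ℕ.suc d} x y n = ℚ.+-mono-≤
  (square-nonNeg (seq (x zero) n ℚ.- seq (y zero) n))
  (dist²-nonNeg (x ∘ suc) (y ∘ suc) n)

dist²-cong-0 : ∀ {x y : ℝ^ d} → (∀ i → x i ≡ y i) → ∀ n → seq (dist² x y) n ≡ 0ℚ
dist²-cong-0 {0}               x≗y n = refl
dist²-cong-0 {ℕ.suc d} {x} {y} x≗y n rewrite x≗y zero =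
  cong₂ ℚ._+_ (cong (λ p → p ℚ.* p) (ℚ.+-inverseʳ (seq (y zero) n)))
    (dist²-cong-0 (x≗y ∘ suc) n)

-- The omitted terms of the sum are squares. The inequality holds at every index of the representing
-- sequences, which is the form that `<-mono-eventually` takes.
dist²-↑ˡ-≤ : ∀ d (x y : ℝ^ (d + e)) n →
  seq (dist² (x ∘ (_↑ˡ e)) (y ∘ (_↑ˡ e))) n ℚ.≤ seq (dist² x y) n
dist²-↑ˡ-≤ 0         x y n = dist²-nonNeg x y n
dist²-↑ˡ-≤ (ℕ.suc d) x y n = ℚ.+-monoʳ-≤
  ((seq (x zero) n ℚ.- seq (y zero) n) ℚ.* (seq (x zero) n ℚ.- seq (y zero) n))
  (dist²-↑ˡ-≤ d (x ∘ suc) (y ∘ suc) n)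

dist²-↑ʳ-≤ : ∀ d (x y : ℝ^ (d + e)) n →
  seq (dist² (x ∘ (d ↑ʳ_)) (y ∘ (d ↑ʳ_))) n ℚ.≤ seq (dist² x y) n
dist²-↑ʳ-≤ 0         x y n = ℚ.≤-refl
dist²-↑ʳ-≤ (ℕ.suc d) x y n = subst (ℚ._≤ seq (dist² x y) n) (ℚ.+-identityˡ _)
  (ℚ.+-mono-≤ (square-nonNeg (seq (x zero) n ℚ.- seq (y zero) n))
    (dist²-↑ʳ-≤ d (x ∘ suc) (y ∘ suc) n))

-- Open sets.

const : ℚ → ℝ
const q = mkℝ (λ _ → q) (const-cauchy q)

-- The gap `δ` witnessing `0ℝ < ε` is a rational that lies below `ε` eventually, so the ball of
-- radius `δ` fits inside the given one. Rational radii have a minimum, which `⊠-open` takes.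
rational-radius : ∀ {U : Pred (ℝ^ d) 0ℓ} → Open U → ∀ x → U x →
  ∃ λ q → 0ℚ ℚ.< q × (∀ y → dist² x y Defs.< const q Defs.* const q → U y)
rational-radius U-open x x∈U =
  let ε , (δ , δ>0 , N , 0+δ≤ε) , ball = U-open x x∈U
  in δ , δ>0 , λ y → ball y ∘ <-mono-eventually (dist² x y) (dist² x y) (const δ Defs.* const δ) (ε Defs.* ε) N
    (λ _ → ℚ.≤-refl)
    (λ n N≤n → square-mono (ℚ.<⇒≤ δ>0) (subst (ℚ._≤ seq ε n) (ℚ.+-identityˡ δ) (0+δ≤ε n N≤n)))

-- Without function extensionality a predicate on ℝ^ d need not respect
-- pointwise equality; openness guarantees that it does.
Open-resp-≗ : ∀ {U : Pred (ℝ^ d) 0ℓ} → Open U → ∀ {x y} → (∀ i → x i ≡ y i) → U x → U y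
Open-resp-≗ U-open {x} {y} x≗y x∈U =
  let q , q>0 , ball = rational-radius U-open x x∈U
      q*q>0 = ℚ.positive⁻¹ (q ℚ.* q) {{ℚ.pos*pos⇒pos q {{positive q>0}} q {{positive q>0}}}}
  in ball y (q ℚ.* q , q*q>0 , 0 , λ n _ → ℚ.≤-reflexive
       (trans (cong (ℚ._+ q ℚ.* q) (dist²-cong-0 x≗y n)) (ℚ.+-identityˡ (q ℚ.* q))))

-- Products of open convex sets.

infixr 7 _⊠_
_⊠_ : Pred (ℝ^ d) 0ℓ → Pred (ℝ^ e) 0ℓ → Pred (ℝ^ (d + e)) 0ℓ
_⊠_ {d} {e} U V z = U (z ∘ (_↑ˡ e)) × V (z ∘ (d ↑ʳ_))

-- The smaller of the two radii works, since neither projection increases the squared distance.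
⊠-open : ∀ {U : Pred (ℝ^ d) 0ℓ} {V : Pred (ℝ^ e) 0ℓ} → Open U → Open V → Open (U ⊠ V)
⊠-open {d} {e} U-open V-open z (z∈U , z∈V) =
  let p , p>0 , ballU = rational-radius U-open (z ∘ (_↑ˡ e)) z∈U
      q , q>0 , ballV = rational-radius V-open (z ∘ (d ↑ʳ_)) z∈V
      r = p ℚ.⊓ q
      r>0 = ⊓-pos p>0 q>0
      r² = const r Defs.* const r
  in const r , (r , r>0 , 0 , λ _ _ → ℚ.≤-reflexive (ℚ.+-identityˡ r)) , λ z′ z′-near →
    ballU (z′ ∘ (_↑ˡ e)) (<-mono-eventually
      (dist² z z′) (dist² (z ∘ (_↑ˡ e)) (z′ ∘ (_↑ˡ e))) r² (const p Defs.* const p) 0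
      (dist²-↑ˡ-≤ d z z′) (λ _ _ → square-mono (ℚ.<⇒≤ r>0) (ℚ.p⊓q≤p p q)) z′-near) ,
    ballV (z′ ∘ (d ↑ʳ_)) (<-mono-eventually
      (dist² z z′) (dist² (z ∘ (d ↑ʳ_)) (z′ ∘ (d ↑ʳ_))) r² (const q Defs.* const q) 0
      (dist²-↑ʳ-≤ d z z′) (λ _ _ → square-mono (ℚ.<⇒≤ r>0) (ℚ.p⊓q≤q p q)) z′-near)

-- Convex combinations are formed coordinatewise, so they commute with both projections by
-- computation.
⊠-convex : ∀ {U : Pred (ℝ^ d) 0ℓ} {V : Pred (ℝ^ e) 0ℓ} →
  ConvexSet U → ConvexSet V → ConvexSet (U ⊠ V)
⊠-convex {d} {e} U-convex V-convex x y (x∈U , x∈V) (y∈U , y∈V) t 0≤t t≤1 =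
  U-convex (x ∘ (_↑ˡ e)) (y ∘ (_↑ˡ e)) x∈U y∈U t 0≤t t≤1 ,
  V-convex (x ∘ (d ↑ʳ_)) (y ∘ (d ↑ʳ_)) x∈V y∈V t 0≤t t≤1

-- The halves of `x Vector.++ y` agree with `x` and `y` only pointwise; openness carries membership
-- across.
++-∈-⊠ : ∀ {U : Pred (ℝ^ d) 0ℓ} {V : Pred (ℝ^ e) 0ℓ} → Open U → Open V →
  ∀ {x y} → U x → V y → (U ⊠ V) (x Vector.++ y)
++-∈-⊠ U-open V-open {x} {y} x∈U y∈V =
  Open-resp-≗ U-open (λ i → sym (Vector.lookup-++ˡ x y i)) x∈U ,
  Open-resp-≗ V-open (λ j → sym (Vector.lookup-++ʳ x y j)) y∈V

-- Codewords as atoms of points.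

-- Merging the conditions for members and non-members into one per index lets a concatenation be
-- treated half by half, and `det` then equates bits that record the same fact about a point.
code⇔reflects : ∀ {U : Fin n → Pred (ℝ^ d) 0ℓ} {X : Pred (ℝ^ d) 0ℓ} {σ : Subset n} →
  code U X σ ⇔ ∃ λ x → X x × (∀ i → Reflects (U i x) (lookup σ i))
code⇔reflects {n} {U = U} {X} {σ} = mk⇔
  (λ (x , (x∈X , x∈⋂) , x∉⋃) → x , x∈X , λ i →
    reflects x i (λ i∈σ → x∈⋂ (i , i∈σ)) (λ i∉σ x∈Ui → x∉⋃ ((i , i∉σ) , x∈Ui)))
  (λ (x , x∈X , r) → x ,
    (x∈X , λ (i , i∈σ) → true⇒ (r i) (Vec.[]=⇒lookup i∈σ)) ,
    λ ((i , i∉σ) , x∈Ui) → i∉σ (Vec.lookup⇒[]= i σ (⇒true (r i) x∈Ui)))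
  where
  reflects : ∀ x i → (i ∈ σ → U i x) → (i ∉ σ → ¬ U i x) → Reflects (U i x) (lookup σ i)
  reflects x i in-σ out-σ with lookup σ i in eq
  ... | true  = ofʸ (in-σ (Vec.lookup⇒[]= i σ eq))
  ... | false = ofⁿ (out-σ λ i∈σ → contradiction (trans (sym eq) (Vec.[]=⇒lookup i∈σ)) λ ())
  true⇒ : ∀ {A : Set} {b} → Reflects A b → b ≡ true → A
  true⇒ (ofʸ a) _ = a
  ⇒true : ∀ {A : Set} {b} → Reflects A b → A → b ≡ true
  ⇒true r a = det r (ofʸ a)

Reflects-⇔ : ∀ {A B : Set} {b} → (A → B) → (B → A) → Reflects A b → Reflects B b
Reflects-⇔ f g (ofʸ a)  = ofʸ (f a)
Reflects-⇔ f g (ofⁿ ¬a) = ofⁿ (¬a ∘ g)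

-- Realizing the product code.

×-convexIn : ∀ {C : Code n} {D : Code m} → ConvexIn d C → ConvexIn e D → ConvexIn (d + e) (C ×ᶜ D)
×-convexIn {n} {m} {d} {e} {C} {D} convC convD = record
  { X        = R.X ⊠ S.X
  ; U        = W
  ; X-open   = ⊠-open R.X-open S.X-open
  ; X-convex = ⊠-convex R.X-convex S.X-convex
  ; U⊆X      = λ k {z} → W-all (λ W → ∀ {z} → W z → (R.X ⊠ S.X) z)
      (λ i (u , y) → R.U⊆X i u , y) (λ j (x , v) → x , S.U⊆X j v) k {z}
  ; U-open   = W-all Open (λ i → ⊠-open (R.U-open i) S.X-open) (λ j → ⊠-open R.X-open (S.U-open j))
  ; U-convex = W-all ConvexSet
      (λ i → ⊠-convex (R.U-convex i) S.X-convex) (λ j → ⊠-convex R.X-convex (S.U-convex j))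
  ; C≐code   = C×D⊆code , code⊆C×D
  }
  where
  module R = ConvexIn convC
  module S = ConvexIn convD

  Wˡ : Vector (Pred (ℝ^ (d + e)) 0ℓ) n
  Wˡ i = R.U i ⊠ S.X

  Wʳ : Vector (Pred (ℝ^ (d + e)) 0ℓ) m
  Wʳ j = R.X ⊠ S.U j

  W : Vector (Pred (ℝ^ (d + e)) 0ℓ) (n + m)
  W = Wˡ Vector.++ Wʳ

  -- `W` does not compute at `i ↑ˡ m` or `n ↑ʳ j`, so facts about the two kinds of cylinder are
  -- transported along the lookup equations.
  W-all : (P : Pred (ℝ^ (d + e)) 0ℓ → Set) → (∀ i → P (Wˡ i)) → (∀ j → P (Wʳ j)) → ∀ k → P (W k)
  W-all P left right = ↑-elim (P ∘ W)
    (λ i → subst P (sym (Vector.lookup-++ˡ Wˡ Wʳ i)) (left i))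
    (λ j → subst P (sym (Vector.lookup-++ʳ Wˡ Wʳ j)) (right j))

  C×D⊆code : ∀ {σ} → σ List.∈ C ×ᶜ D → code W (R.X ⊠ S.X) σ
  C×D⊆code σ∈ with ∈-cartesianProductWith⁻ Vec._++_ C D σ∈
  ... | a , b , a∈C , b∈D , refl
    with Equivalence.to code⇔reflects (proj₁ R.C≐code a∈C)
       | Equivalence.to code⇔reflects (proj₁ S.C≐code b∈D)
  ... | x , x∈X , rx | y , y∈Y , ry = Equivalence.from code⇔reflects
    (z , z∈X×Y , ↑-elim (λ k → Reflects (W k z) (lookup (a Vec.++ b) k)) left right)
    where
    z = x Vector.++ y
    z∈X×Y = ++-∈-⊠ R.X-open S.X-open x∈X y∈Y
    left : ∀ i → Reflects (W (i ↑ˡ m) z) (lookup (a Vec.++ b) (i ↑ˡ m))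
    -- As `y` lies in `S.X`, the cylinder over `R.U i` contains `z` exactly when `R.U i` contains
    -- `x`.
    left i rewrite Vector.lookup-++ˡ Wˡ Wʳ i | Vec.lookup-++ˡ a b i = Reflects-⇔
      (λ u → ++-∈-⊠ (R.U-open i) S.X-open u y∈Y)
      (λ (u , _) → Open-resp-≗ (R.U-open i) (Vector.lookup-++ˡ x y) u) (rx i)
    right : ∀ j → Reflects (W (n ↑ʳ j) z) (lookup (a Vec.++ b) (n ↑ʳ j))
    right j rewrite Vector.lookup-++ʳ Wˡ Wʳ j | Vec.lookup-++ʳ a b j = Reflects-⇔
      (λ v → ++-∈-⊠ R.X-open (S.U-open j) x∈X v)
      (λ (_ , v) → Open-resp-≗ (S.U-open j) (Vector.lookup-++ʳ x y) v) (ry j)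

  code⊆C×D : ∀ {σ} → code W (R.X ⊠ S.X) σ → σ List.∈ C ×ᶜ D
  code⊆C×D {σ} σ∈ with Vec.splitAt n σ
  ... | a , b , refl with Equivalence.to (code⇔reflects {σ = a Vec.++ b}) σ∈
  -- Both projections of `z` lie in their ambient sets, so a cylinder contains `z` exactly when its
  -- base contains the projection. Hence the projections have atoms `a` and `b`.
  ... | z , (z∈X , z∈Y) , r = ∈-cartesianProductWith⁺ Vec._++_
    (proj₂ R.C≐code (Equivalence.from (code⇔reflects {σ = a}) (z ∘ (_↑ˡ e) , z∈X , λ i →
      Reflects-⇔ proj₁ (_, z∈Y)
        (subst₂ (λ W b → Reflects (W z) b) (Vector.lookup-++ˡ Wˡ Wʳ i) (Vec.lookup-++ˡ a b i) (r (i ↑ˡ m))))))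
    (proj₂ S.C≐code (Equivalence.from (code⇔reflects {σ = b}) (z ∘ (d ↑ʳ_) , z∈Y , λ j →
      Reflects-⇔ proj₂ (z∈X ,_)
        (subst₂ (λ W b → Reflects (W z) b) (Vector.lookup-++ʳ Wˡ Wʳ j) (Vec.lookup-++ʳ a b j) (r (n ↑ʳ j))))))

-- Recovering the factors.

-- Serves both factors, with `f` the inclusion of the first or of the last indices. The ambient set
-- is kept, and so is the dimension.
reindex-convexIn : ∀ {C : Code k} {E : Code l} (f : Fin k → Fin l) →
  (∀ σ → σ List.∈ C ⇔ ∃ λ τ → τ List.∈ E × (∀ i → lookup σ i ≡ lookup τ (f i))) →
  ConvexIn d E → ConvexIn d C
reindex-convexIn {C = C} f C⇔E convE = record
  { X        = X
  ; U        = U ∘ f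
  ; X-open   = X-open
  ; X-convex = X-convex
  ; U⊆X      = U⊆X ∘ f
  ; U-open   = U-open ∘ f
  ; U-convex = U-convex ∘ f
  ; C≐code   = C⊆code , code⊆C
  }
  where
  open ConvexIn convE
  open DecMembership (Vec.≡-dec Bool._≟_) using (_∈?_)

  C⊆code : ∀ {σ} → σ List.∈ C → code (U ∘ f) X σ
  C⊆code {σ} σ∈C with Equivalence.to (C⇔E σ) σ∈C
  ... | τ , τ∈E , σ≗τ∘f with Equivalence.to code⇔reflects (proj₁ C≐code τ∈E)
  ... | x , x∈X , r = Equivalence.from code⇔reflects
    (x , x∈X , λ i → subst (Reflects (U (f i) x)) (sym (σ≗τ∘f i)) (r (f i)))

  -- Which of the U j contain a given point is undecidable, but the goal is
  -- decidable, so the atom of the point may be assumed to exist.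
  code⊆C : ∀ {σ} → code (U ∘ f) X σ → σ List.∈ C
  code⊆C {σ} σ∈ with Equivalence.to (code⇔reflects {σ = σ}) σ∈
  ... | x , x∈X , r = decidable-stable (σ ∈? C) (¬¬-map from-decisions
    (Fin.sequence (RawMonad.rawApplicative ¬¬-Monad) (λ j → ¬¬-excluded-middle)))
    where
    from-decisions : (∀ j → Dec (U j x)) → σ List.∈ C
    from-decisions U? = Equivalence.from (C⇔E σ)
      ( τ
      , proj₂ C≐code (Equivalence.from code⇔reflects (x , x∈X , rτ))
      , λ i → det (r i) (rτ (f i)))
      where
      τ = tabulate (does ∘ U?)
      rτ : ∀ j → Reflects (U j x) (lookup τ j)
      rτ j = subst (Reflects (U j x)) (sym (Vec.lookup∘tabulate (does ∘ U?) j)) (proof (U? j))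

inhabited : ∀ {C : Code n} → C ≢ [] → ∃ (List._∈ C)
inhabited {C = []}    C≢[] = contradiction refl C≢[]
inhabited {C = c ∷ _} _    = c , here refl

-- A codeword of `D` completes each codeword of `C` to one of the product; for empty `D` the product
-- would be empty and say nothing about `C`.
×-convexIn⁻ˡ : ∀ {C : Code n} {D : Code m} → D ≢ [] → ConvexIn d (C ×ᶜ D) → ConvexIn d C
×-convexIn⁻ˡ {n} {m} {C = C} {D} D≢[] = reindex-convexIn (_↑ˡ m) λ σ → mk⇔
  (λ σ∈C → let b , b∈D = inhabited D≢[] in
    σ Vec.++ b , ∈-cartesianProductWith⁺ Vec._++_ σ∈C b∈D , λ i → sym (Vec.lookup-++ˡ σ b i))
  λ (τ , τ∈C×D , σ≗τ) → let a , b , a∈C , b∈D , τ≡a++b = ∈-cartesianProductWith⁻ Vec._++_ C D τ∈C×D in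
    subst (List._∈ C)
      (sym (lookup-ext λ i → trans (σ≗τ i)
        (trans (cong (λ τ → lookup τ (i ↑ˡ m)) τ≡a++b) (Vec.lookup-++ˡ a b i))))
      a∈C

×-convexIn⁻ʳ : ∀ {C : Code n} {D : Code m} → C ≢ [] → ConvexIn d (C ×ᶜ D) → ConvexIn d D
×-convexIn⁻ʳ {n} {m} {C = C} {D} C≢[] = reindex-convexIn (n ↑ʳ_) λ σ → mk⇔
  (λ σ∈D → let a , a∈C = inhabited C≢[] in
    a Vec.++ σ , ∈-cartesianProductWith⁺ Vec._++_ a∈C σ∈D , λ j → sym (Vec.lookup-++ʳ a σ j))
  λ (τ , τ∈C×D , σ≗τ) → let a , b , a∈C , b∈D , τ≡a++b = ∈-cartesianProductWith⁻ Vec._++_ C D τ∈C×D in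
    subst (List._∈ D)
      (sym (lookup-ext λ j → trans (σ≗τ j)
        (trans (cong (λ τ → lookup τ (n ↑ʳ j)) τ≡a++b) (Vec.lookup-++ʳ a b j))))
      b∈D

theorem4p3 : ∀ {n m : ℕ} (C : Code n) (D : Code m) → C ≢ [] → D ≢ [] →
    ((Convex C × Convex D) ⇔ Convex (C ×ᶜ D)) ×
    (Convex C × Convex D → ∀ p q r → IsMinDim C p → IsMinDim D q → IsMinDim (C ×ᶜ D) r → r ≤ p + q)
theorem4p3 C D C≢[] D≢[] =
  mk⇔ (λ ((p , convC) , (q , convD)) → p + q , ×-convexIn convC convD)
      (λ (r , conv) → (r , ×-convexIn⁻ˡ D≢[] conv) , (r , ×-convexIn⁻ʳ C≢[] conv)) ,
  -- The product of the two minimal realizations has dimension `p + q`, and the minimality of `r` is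
  -- applied to it.
  λ _ p q r (convC , _) (convD , _) (_ , least) → least (p + q) (×-convexIn convC convD)
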